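{- Let $n\ge 1$. The number of permutations in $S_n$ which have exactly $n$ different separators is $2^k\,k!$ if $n=4k$ for some positive integer $k$, and $0$ otherwise.
   Context: Permutations $\sigma\in S_n$ are written in one-line notation $\sigma=[\sigma_1,\dots,\sigma_n]$. The digit $\sigma_i$ is a vertical separator of $\sigma$ if $1<i<n$ and $|\sigma_{i-1}-\sigma_{i+1}|=1$. The digit $\sigma_i=a$ is a horizontal separator of $\sigma$ if $1<a<n$ and the values $a-1$ and $a+1$ occupy adjacent positions in $\sigma$, i.e. $|\sigma^{ -1}(a-1)-\sigma^{ -1}(a+1)|=1$. A digit is a separator of $\sigma$ if it is a vertical separator or a horizontal separator (or both); a digit that is of both types is counted once. -}

module Defs where

open import Data.Fin using (Fin; toℕ)
open import Data.Fin.Permutation using (Permutation′; _⟨$⟩ʳ_; _⟨$⟩ˡ_; _≈_)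
open import Data.Fin.Properties using (any?)
open import Data.List using (allFin; filter; length)
open import Data.Nat using (ℕ; suc; ∣_-_∣; _≟_)
open import Data.Product using (Σ-syntax; ∃₂; _×_; proj₁)
open import Data.Sum using (_⊎_)
open import Function.Bundles using (Inverse)
open import Level using (Level; 0ℓ; _⊔_)
open import Relation.Binary.Bundles using (Setoid)
import Relation.Binary.Construct.On as On
open import Relation.Binary.PropositionalEquality as ≡ using (_≡_)
open import Relation.Nullary using (Dec)
open import Relation.Nullary.Decidable using (_×-dec_; _⊎-dec_)

private
  variable
    c ℓ : Level
    n : ℕ

-- Positions and digits are both elements of Fin n, so 1, …, n become
-- 0, …, n - 1.  In one-line notation the digit at position i of σ is
-- σ ⟨$⟩ʳ i, and the position of the digit a is σ ⟨$⟩ˡ a.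

-- Neighbours i j k says j = i - 1 and k = i + 1.  Since j and k are elements
-- of Fin n, their existence is exactly the condition 1 < i < n
-- (for one-based i) in the definitions of the two kinds of separator.
Neighbours : Fin n → Fin n → Fin n → Set
Neighbours i j k = toℕ i ≡ suc (toℕ j) × toℕ k ≡ suc (toℕ i)

VerticalSeparator : Permutation′ n → Fin n → Set
VerticalSeparator σ a = ∃₂ λ j k →
  Neighbours (σ ⟨$⟩ˡ a) j k × ∣ toℕ (σ ⟨$⟩ʳ j) - toℕ (σ ⟨$⟩ʳ k) ∣ ≡ 1

HorizontalSeparator : Permutation′ n → Fin n → Set
HorizontalSeparator σ a = ∃₂ λ b d →
  Neighbours a b d × ∣ toℕ (σ ⟨$⟩ˡ b) - toℕ (σ ⟨$⟩ˡ d) ∣ ≡ 1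

Separator : Permutation′ n → Fin n → Set
Separator σ a = VerticalSeparator σ a ⊎ HorizontalSeparator σ a

neighbours? : (i j k : Fin n) → Dec (Neighbours i j k)
neighbours? i j k = (toℕ i ≟ suc (toℕ j)) ×-dec (toℕ k ≟ suc (toℕ i))

verticalSeparator? : (σ : Permutation′ n) (a : Fin n) → Dec (VerticalSeparator σ a)
verticalSeparator? σ a = any? λ j → any? λ k →
  neighbours? (σ ⟨$⟩ˡ a) j k ×-dec (∣ toℕ (σ ⟨$⟩ʳ j) - toℕ (σ ⟨$⟩ʳ k) ∣ ≟ 1)

horizontalSeparator? : (σ : Permutation′ n) (a : Fin n) → Dec (HorizontalSeparator σ a)
horizontalSeparator? σ a = any? λ b → any? λ d →
  neighbours? a b d ×-dec (∣ toℕ (σ ⟨$⟩ˡ b) - toℕ (σ ⟨$⟩ˡ d) ∣ ≟ 1)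

separator? : (σ : Permutation′ n) (a : Fin n) → Dec (Separator σ a)
separator? σ a = verticalSeparator? σ a ⊎-dec horizontalSeparator? σ a

numberOfSeparators : Permutation′ n → ℕ
numberOfSeparators {n} σ = length (filter (separator? σ) (allFin n))

-- Permutation′ n is a record containing proofs, so two permutations are
-- identified when they agree at every position, not when they are _≡_.
permutationSetoid : ℕ → Setoid 0ℓ 0ℓ
permutationSetoid n = record
  { Carrier       = Permutation′ n
  ; _≈_           = _≈_
  ; isEquivalence = record
    { refl  = λ _ → ≡.refl
    ; sym   = λ p i → ≡.sym (p i)
    ; trans = λ p q i → ≡.trans (p i) (q i)
    }
  }

PermutationsWithSeparators : (n m : ℕ) → Setoid 0ℓ 0ℓ
PermutationsWithSeparators n m =
  On.setoid {B = Σ[ σ ∈ Permutation′ n ] numberOfSeparators σ ≡ m}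
            (permutationSetoid n) proj₁

HasCardinality : Setoid c ℓ → ℕ → Set (c ⊔ ℓ)
HasCardinality S N = Inverse (≡.setoid (Fin N)) S

{-# OPTIONS --safe #-}

-- Suppose every digit is a separator.  The digit a in the leftmost column is
-- not a vertical separator, so a - 1 and a + 1 are in adjacent columns.  As the
-- digits a - 1 and a + 1 are separators too, either the first four columns
-- hold a pattern 2413 or 3142 on four consecutive values, or the permutation
-- begins with a zigzag a, a - 1, a + 1, a - 2, a + 2, … (up to turning it
-- upside down) that can never stop, which is impossible.  After the first four
-- columns are deleted, the remaining digits are still separators, so all of σ
-- consists of such patterns, and by induction from the bottom their rows are
-- aligned to multiples of 4.  Hence n = 4k, and σ is the inflation of a
-- permutation of k points by arbitrary choices of 2413 or 3142; all inflations
-- do occur.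
module Submission where

open import Defs
open import Data.Empty using (⊥; ⊥-elim)
open import Data.Fin
  using (Fin; zero; suc; toℕ; fromℕ<; combine; remQuot; quotient; remainder; opposite;
         punchIn; finToFun; funToFin)
open import Data.Fin.Patterns using (0F; 1F; 2F; 3F)
open import Data.Fin.Permutation as Permutation
  using (Permutation′; permutation; _⟨$⟩ʳ_; _⟨$⟩ˡ_; _≈_; inverseˡ; inverseʳ; insert;
         remove; insert-punchIn; punchIn-permute)
open import Data.Fin.Properties
  using (toℕ<n; toℕ-fromℕ<; toℕ-injective; toℕ-combine; combine-injectiveˡ;
         combine-injective; combine-surjective; combine-remQuot; remQuot-combine;
         punchIn-injective; finToFun-funToFin)
open import Data.Integer as ℤ using (ℤ; +_; -[1+_]; 0ℤ; 1ℤ; -1ℤ)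
import Data.Integer.Properties as ℤ
open import Data.Integer.Tactic.RingSolver using (solve-∀)
open import Data.List using (allFin; length)
open import Data.List.Membership.Propositional using (lose)
open import Data.List.Membership.Propositional.Properties using (∈-allFin)
open import Data.List.Properties using (length-tabulate; filter-all; filter-notAll)
import Data.List.Relation.Unary.All as All
open import Data.Nat using (ℕ; zero; suc; _+_; _*_; _^_; _≤_; _<_; _!; z≤n; s≤s; ∣_-_∣)
import Data.Nat.Properties as ℕ
open import Data.Product using (_×_; ∃-syntax; _,_; proj₁; proj₂)
open import Data.Sum using (_⊎_; inj₁; inj₂)
open import Function.Bundles using (Injection)
open import Function.Properties.Inverse using (↔⇒↣)
open import Relation.Binary.Bundles using (Setoid)
open import Relation.Binary.PropositionalEquality
  using (_≡_; refl; sym; trans; cong; cong₂; subst; subst₂)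
open import Relation.Nullary using (¬_; yes; no)

-- Configurations with integer values and their reflections

private
  variable
    M N i j h k n : ℕ
    u v c : ℤ
    R S : ℕ → ℤ → Set

-- R i v is to be read as: column i contains the value v.  Integer values allow
-- the configuration to be translated and turned upside down.  ascent and
-- descent are vertical separation, the other two are horizontal separation.
data Separated (R : ℕ → ℤ → Set) : ℕ → ℤ → Set where
  ascent      : R h u → R (2 + h) (ℤ.suc u) → Separated R (1 + h) v
  descent     : R h u → R (2 + h) (ℤ.pred u) → Separated R (1 + h) v
  rowsAscend  : R j (ℤ.pred v) → R (1 + j) (ℤ.suc v) → Separated R i v
  rowsDescend : R j (ℤ.suc v) → R (1 + j) (ℤ.pred v) → Separated R i v

-- The values may be any `N` distinct integers, gaps included, so that the notion survives the
-- deletion of columns.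
record FullySeparated (N : ℕ) (R : ℕ → ℤ → Set) : Set where
  field
    bounded    : R i v → i < N
    total      : i < N → ∃[ v ] R i v
    functional : R i u → R i v → u ≡ v
    injective  : R i v → R j v → i ≡ j
    separated  : R i v → Separated R i v

open FullySeparated

-- The identities are stated with the operators that the ring solver recognises.
c-[c-v]≡v : ∀ c v → c ℤ.- (c ℤ.- v) ≡ v
c-[c-v]≡v = identity
  where
  identity : ∀ c v → c ℤ.+ ℤ.- (c ℤ.+ ℤ.- v) ≡ v
  identity = solve-∀

c-suc : ∀ c v → c ℤ.- ℤ.suc v ≡ ℤ.pred (c ℤ.- v)
c-suc = identity
  where
  identity : ∀ c v → c ℤ.+ ℤ.- (1ℤ ℤ.+ v) ≡ -1ℤ ℤ.+ (c ℤ.+ ℤ.- v)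
  identity = solve-∀

c-pred : ∀ c v → c ℤ.- ℤ.pred v ≡ ℤ.suc (c ℤ.- v)
c-pred = identity
  where
  identity : ∀ c v → c ℤ.+ ℤ.- (-1ℤ ℤ.+ v) ≡ 1ℤ ℤ.+ (c ℤ.+ ℤ.- v)
  identity = solve-∀

reflect : ℤ → (ℕ → ℤ → Set) → ℕ → ℤ → Set
reflect c R i v = R i (c ℤ.- v)

separated-reflect : (∀ {i v} → R i v → S i (c ℤ.- v)) →
                    Separated R i v → Separated S i (c ℤ.- v)
separated-reflect {S = S} {c = c} f (ascent {u = u} p q) =
  descent (f p) (subst (S _) (c-suc c u) (f q))
separated-reflect {S = S} {c = c} f (descent {u = u} p q) =
  ascent (f p) (subst (S _) (c-pred c u) (f q))
separated-reflect {S = S} {c = c} {v = v} f (rowsAscend p q) =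
  rowsDescend (subst (S _) (c-pred c v) (f p)) (subst (S _) (c-suc c v) (f q))
separated-reflect {S = S} {c = c} {v = v} f (rowsDescend p q) =
  rowsAscend (subst (S _) (c-suc c v) (f p)) (subst (S _) (c-pred c v) (f q))

-- With S = reflect c R or R = reflect c S: reflecting twice is the identity
-- only up to propositional equality of values.
fullySeparated-reflect : (∀ {i v} → R i v → S i (c ℤ.- v)) →
                         (∀ {i v} → S i v → R i (c ℤ.- v)) →
                         FullySeparated N R → FullySeparated N S
fullySeparated-reflect {S = S} {c = c} f g F = record
  { bounded    = λ p → bounded F (g p)
  ; total      = λ l → let v , p = total F l in c ℤ.- v , f p
  ; functional = λ {i} {u} {v} p q → trans (sym (c-[c-v]≡v c u))
                   (trans (cong (λ w → c ℤ.- w) (functional F (g p) (g q))) (c-[c-v]≡v c v))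
  ; injective  = λ p q → injective F (g p) (g q)
  ; separated  = λ {i} {v} p → subst (Separated S i) (c-[c-v]≡v c v)
                   (separated-reflect {c = c} f (separated F (g p)))
  }

reflected : ∀ c → FullySeparated N R → FullySeparated N (reflect c R)
reflected {R = R} c = fullySeparated-reflect {c = c}
  (λ {_} {v} → subst (R _) (sym (c-[c-v]≡v c v))) (λ p → p)

unreflected : ∀ c → FullySeparated N (reflect c R) → FullySeparated N R
unreflected {R = R} c = fullySeparated-reflect {c = c}
  (λ p → p) (λ {_} {v} → subst (R _) (sym (c-[c-v]≡v c v)))

-- The first four columns

suc-flip : ∀ u → ℤ.suc u ≡ v → u ≡ ℤ.pred v
suc-flip u refl = sym (ℤ.pred-suc u)

pred-flip : ∀ u → ℤ.pred u ≡ v → u ≡ ℤ.suc v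
pred-flip u refl = sym (ℤ.suc-pred u)

-- The next column must contain -1.  Reflecting in 2 + d turns columns
-- 1 + t, …, 4 + t into the same picture with 1 + d for d.
no-zigzag : FullySeparated N R → (fuel d t : ℕ) → N ≤ fuel + t →
            R t (+ 1) → R (1 + t) (+ (1 + d)) → R (2 + t) (+ 0) → R (3 + t) (+ (2 + d)) → ⊥
-- Each step trades one unit of fuel for one column, which preserves `N ≤ fuel + t`; with no fuel
-- left, column `t` lies outside the `N` columns.
no-zigzag F zero d t N≤t p₀ _ _ _ = ℕ.<-irrefl refl (ℕ.<-≤-trans (bounded F p₀) N≤t)
no-zigzag {N = N} {R = R} F (suc fuel) d t N≤ p₀ p₁ p₂ p₃ with separated F p₃
... | ascent p q with refl ← functional F p p₂ with () ← injective F q p₀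
... | rowsAscend p q with refl ← injective F p p₁ with () ← functional F q p₂
... | rowsDescend p q with refl ← injective F q p₁ with () ← functional F p p₀
... | descent p q with refl ← functional F p p₂ =
  no-zigzag (reflected e F) fuel (suc d) (suc t) (subst (N ≤_) (sym (ℕ.+-suc fuel t)) N≤) p₁
    (subst (R _) (sym (ℤ.+-inverseʳ e)) p₂)
    (subst (R _) (sym (ℤ.+-identityʳ e)) p₃)
    (subst (R _) (sym (d-suc[d] e)) q)
  where
  e = + (2 + d)
  d-suc[d] : ∀ x → x ℤ.+ ℤ.- (1ℤ ℤ.+ x) ≡ -1ℤ
  d-suc[d] = solve-∀

-- The pattern 2413, translated so that its first digit becomes 0.
record Block (R : ℕ → ℤ → Set) : Set where
  field
    at₀ : R 0 (+ 0)
    at₁ : R 1 (+ 2)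
    at₂ : R 2 -[1+ 0 ]
    at₃ : R 3 (+ 1)

-- The column `j` of -1 decides. If `j` is 0, it collides with the first digit; if 1, a zigzag
-- starts; if 2, the separation of -1 and 1 forces the block; beyond that, the separations of -1 and
-- 1 cannot be reconciled.
ascending-block : FullySeparated N R → R 0 (+ 0) →
                  R j -[1+ 0 ] → R (1 + j) (+ 1) → Block R
ascending-block {j = 0} F p q r with () ← functional F p q
ascending-block {N = N} {R = R} {j = 1} F p q r = ⊥-elim (contra (separated F r))
  where
  contra : Separated R 2 (+ 1) → ⊥
  contra (ascent p′ q′) with refl ← functional F p′ q with () ← injective F q′ p
  contra (rowsAscend p′ q′) with refl ← injective F p′ p with () ← functional F q′ q
  contra (rowsDescend p′ q′) with () ← injective F q′ p
  -- Columns 0 to 3 hold 0, -1, 1, -2, which `v` to `1 - v` turns into the zigzag 1, 2, 0, 3.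
  contra (descent p′ q′) with refl ← functional F p′ q =
    no-zigzag (reflected (+ 1) F) N 1 0 (ℕ.m≤m+n N 0) p q r q′
ascending-block {R = R} {j = 2} F p q r = step (separated F q)
  where
  contra : R 1 -[1+ 1 ] → Separated R 3 (+ 1) → ⊥
  contra s (ascent p′ q′) with refl ← functional F p′ q with () ← injective F q′ p
  contra s (descent p′ q′) with refl ← functional F p′ q with () ← injective F q′ s
  contra s (rowsAscend p′ q′) with refl ← injective F p′ p with () ← functional F q′ s
  contra s (rowsDescend p′ q′) with () ← injective F q′ p
  step : Separated R 2 -[1+ 0 ] → Block R
  step (ascent {u = u} p′ q′) with refl ← suc-flip u (functional F q′ r) with () ← injective F p′ p
  step (descent {u = u} p′ q′) with refl ← pred-flip u (functional F q′ r) =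
    record { at₀ = p ; at₁ = p′ ; at₂ = q ; at₃ = r }
  step (rowsAscend p′ q′) with () ← injective F q′ p
  step (rowsDescend p′ q′) with refl ← injective F p′ p = ⊥-elim (contra q′ (separated F r))
ascending-block {R = R} {j = suc (suc (suc k))} F p q r =
  ⊥-elim (contra (left (separated F q)) (right (separated F r)))
  where
  left : Separated R (3 + k) -[1+ 0 ] → R (2 + k) (+ 2) ⊎ R 1 -[1+ 1 ]
  left (ascent {u = u} p′ q′) with refl ← suc-flip u (functional F q′ r) with () ← injective F p′ p
  left (descent {u = u} p′ q′) with refl ← pred-flip u (functional F q′ r) = inj₁ p′
  left (rowsAscend p′ q′) with () ← injective F q′ p
  left (rowsDescend p′ q′) with refl ← injective F p′ p = inj₂ q′
  right : Separated R (4 + k) (+ 1) → R (5 + k) -[1+ 1 ] ⊎ R 1 (+ 2)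
  right (ascent p′ q′) with refl ← functional F p′ q with () ← injective F q′ p
  right (descent p′ q′) with refl ← functional F p′ q = inj₁ q′
  right (rowsAscend p′ q′) with refl ← injective F p′ p = inj₂ q′
  right (rowsDescend p′ q′) with () ← injective F q′ p
  stuck : R (2 + k) (+ 2) → Separated R (5 + k) -[1+ 1 ] → ⊥
  stuck s (ascent p′ q′) with refl ← functional F p′ r with () ← injective F q′ s
  stuck s (descent p′ q′) with refl ← functional F p′ r with () ← injective F q′ p
  stuck s (rowsAscend p′ q′) with refl ← injective F q′ q with () ← functional F p′ s
  stuck s (rowsDescend p′ q′) with refl ← injective F p′ q with () ← functional F q′ r
  -- If both first alternatives hold, columns `2 + k` to `5 + k` read 2, -1, 1, -2, and then -2 is
  -- not a separator. Otherwise 2 or -2 would lie in two columns, or column 1 would hold both.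
  contra : R (2 + k) (+ 2) ⊎ R 1 -[1+ 1 ] → R (5 + k) -[1+ 1 ] ⊎ R 1 (+ 2) → ⊥
  contra (inj₁ s) (inj₁ t) = stuck s (separated F t)
  contra (inj₁ s) (inj₂ t) with () ← injective F s t
  contra (inj₂ s) (inj₁ t) with () ← injective F s t
  contra (inj₂ s) (inj₂ t) with () ← functional F s t

-- Deleting a block, and the tiling

dropColumns : (ℕ → ℤ → Set) → ℕ → ℤ → Set
dropColumns R i v = R (4 + i) v

-- Suppose that a later digit were separated by means of a deleted column. Vertically, column 5
-- would repeat 0 or 2 from the block. Horizontally, either the digit itself would be one of the
-- block values -1 to 2, or column 2 or 3 would hold a wrong value.
dropped : FullySeparated (4 + M) R → Block R → FullySeparated M (dropColumns R)
dropped {R = R} F B = record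
  { bounded    = λ p → ℕ.+-cancelˡ-< 4 _ _ (bounded F p)
  ; total      = λ l → total F (ℕ.+-monoʳ-< 4 l)
  ; functional = functional F
  ; injective  = λ p q → ℕ.+-cancelˡ-≡ 4 _ _ (injective F p q)
  ; separated  = λ p → lower p (separated F p)
  }
  where
  open Block B
  lower : R (4 + i) v → Separated R (4 + i) v → Separated (dropColumns R) i v
  lower {i = 0} s (ascent p q) with refl ← functional F p at₃ with () ← injective F q at₁
  lower {i = 0} s (descent p q) with refl ← functional F p at₃ with () ← injective F q at₀
  lower {i = suc _} s (ascent p q) = ascent p q
  lower {i = suc _} s (descent p q) = descent p q
  lower s (rowsAscend {j = suc (suc (suc (suc _)))} p q) = rowsAscend p q
  lower {v = v} s (rowsAscend {j = 0} p q)
    with refl ← pred-flip v (functional F p at₀) with () ← injective F s at₃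
  lower {v = v} s (rowsAscend {j = 1} p q)
    with refl ← pred-flip v (functional F p at₁) with () ← functional F q at₂
  lower {v = v} s (rowsAscend {j = 2} p q)
    with refl ← pred-flip v (functional F p at₂) with () ← injective F s at₀
  lower {v = v} s (rowsAscend {j = 3} p q)
    with refl ← pred-flip v (functional F p at₃) with () ← injective F s at₁
  lower s (rowsDescend {j = suc (suc (suc (suc _)))} p q) = rowsDescend p q
  lower {v = v} s (rowsDescend {j = 0} p q)
    with refl ← suc-flip v (functional F p at₀) with () ← injective F s at₂
  lower {v = v} s (rowsDescend {j = 1} p q)
    with refl ← suc-flip v (functional F p at₁) with () ← injective F s at₃
  lower {v = v} s (rowsDescend {j = 2} p q)
    with refl ← suc-flip v (functional F p at₂) with () ← functional F q at₃
  lower {v = v} s (rowsDescend {j = 3} p q)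
    with refl ← suc-flip v (functional F p at₃) with () ← injective F s at₀

-- 2413 and 3142, with positions and digits counted from 0; as permutations they
-- are mutually inverse.
motif : Fin 2 → Fin 4 → Fin 4
motif 0F 0F = 1F
motif 0F 1F = 3F
motif 0F 2F = 0F
motif 0F 3F = 2F
motif 1F 0F = 2F
motif 1F 1F = 0F
motif 1F 2F = 3F
motif 1F 3F = 1F

Tile : (ℕ → ℤ → Set) → ℕ → Set
Tile R i = ∃[ t ] ∃[ b ] ∀ r → R (i + toℕ r) (b ℤ.+ + toℕ (motif t r))

-- The shortened configuration is offered under an equation on lengths, because the existence of
-- four columns is itself learnt from the tile.
first-tile : FullySeparated (suc N) R →
             Tile R 0 × (∀ {M} → suc N ≡ 4 + M → FullySeparated M (dropColumns R))
first-tile {N = N} {R = R} F with total F (s≤s z≤n)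
... | a , p = go (separated F′ at₀)
  where
  F′ = reflected a F
  at₀ : reflect a R 0 (+ 0)
  at₀ = subst (R 0) (sym (ℤ.+-identityʳ a)) p
  shift : ∀ i x y → R i (a ℤ.+ (x ℤ.+ y)) → R i (a ℤ.+ x ℤ.+ y)
  shift i x y = subst (R i) (sym (ℤ.+-assoc a x y))
  go : Separated (reflect a R) 0 (+ 0) →
       Tile R 0 × (∀ {M} → suc N ≡ 4 + M → FullySeparated M (dropColumns R))
  -- Column 0 has no left neighbour, so only horizontal separation remains. Before reflection the
  -- block reads `a`, `a - 2`, `a + 1`, `a - 1`: the motif 3142 with lowest value `a - 2`.
  go (rowsAscend q r) = (1F , a ℤ.+ -[1+ 1 ] , tile) , λ { refl → unreflected a (dropped F′ B) }
    where
    B = ascending-block F′ at₀ q r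
    tile : ∀ r → R (toℕ r) (a ℤ.+ -[1+ 1 ] ℤ.+ + toℕ (motif 1F r))
    tile 0F = shift 0 -[1+ 1 ] (+ 2) (Block.at₀ B)
    tile 1F = shift 1 -[1+ 1 ] (+ 0) (Block.at₁ B)
    tile 2F = shift 2 -[1+ 1 ] (+ 3) (Block.at₂ B)
    tile 3F = shift 3 -[1+ 1 ] (+ 1) (Block.at₃ B)
  -- A second reflection restores the orientation: the digits are `a`, `a + 2`, `a - 1`, `a + 1`,
  -- the motif 2413 with lowest value `a - 1`.
  go (rowsDescend q r) =
    (0F , a ℤ.+ -[1+ 0 ] , tile) , λ { refl → unreflected a (unreflected 0ℤ (dropped F″ B)) }
    where
    F″ = reflected 0ℤ F′
    B = ascending-block F″ at₀ q r
    tile : ∀ r → R (toℕ r) (a ℤ.+ -[1+ 0 ] ℤ.+ + toℕ (motif 0F r))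
    tile 0F = shift 0 -[1+ 0 ] (+ 1) (Block.at₀ B)
    tile 1F = shift 1 -[1+ 0 ] (+ 3) (Block.at₁ B)
    tile 2F = shift 2 -[1+ 0 ] (+ 0) (Block.at₂ B)
    tile 3F = shift 3 -[1+ 0 ] (+ 2) (Block.at₃ B)

-- The number of tiles is part of the conclusion, so this also excludes lengths that are not
-- multiples of 4.
tiles : FullySeparated N R → ∃[ k ] N ≡ k * 4 × (∀ (q : Fin k) → Tile R (toℕ q * 4))
tiles {N = 0} F = 0 , refl , λ ()
tiles {N = suc N} F with first-tile F
-- Column 3 of the tile lies within bounds, which exposes four successors in the length and lets the
-- length equation hold by `refl`.
... | (t , b , tile) , rest with bounded F (tile 3F)
tiles {N = suc (suc (suc (suc N)))} F | first , rest | s≤s (s≤s (s≤s (s≤s _)))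
  with tiles (rest refl)
... | k , refl , later = suc k , refl , λ { zero → first ; (suc q) → later q }

-- From permutations to configurations

graph : Permutation′ n → ℕ → ℤ → Set
graph σ i v = ∃[ x ] toℕ x ≡ i × + toℕ (σ ⟨$⟩ʳ x) ≡ v

∣m-n∣≡1⇒ : ∀ m n → ∣ m - n ∣ ≡ 1 → n ≡ suc m ⊎ m ≡ suc n
∣m-n∣≡1⇒ zero    _       e = inj₁ e
∣m-n∣≡1⇒ (suc m) zero    e = inj₂ e
∣m-n∣≡1⇒ (suc m) (suc n) e with ∣m-n∣≡1⇒ m n e
... | inj₁ p = inj₁ (cong suc p)
... | inj₂ p = inj₂ (cong suc p)

graph-fullySeparated : (σ : Permutation′ n) → (∀ a → Separator σ a) →
                       FullySeparated n (graph σ)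
graph-fullySeparated {n = n} σ separator = record
  { bounded    = λ { (x , refl , _) → toℕ<n x }
  ; total      = λ l → _ , fromℕ< l , toℕ-fromℕ< l , refl
  ; functional = λ { (x , p , refl) (y , q , refl) →
                     cong (λ z → + toℕ (σ ⟨$⟩ʳ z)) (toℕ-injective (trans p (sym q))) }
  ; injective  = λ { (x , refl , p) (y , refl , q) →
                     cong toℕ (Injection.injective (↔⇒↣ σ)
                       (toℕ-injective (ℤ.+-injective (trans p (sym q))))) }
  ; separated  = λ { (x , refl , refl) → separated-at x (separator (σ ⟨$⟩ʳ x)) }
  }
  where
  digit : ∀ a → graph σ (toℕ (σ ⟨$⟩ˡ a)) (+ toℕ a)
  digit a = σ ⟨$⟩ˡ a , refl , cong (λ b → + toℕ b) (inverseʳ σ)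
  value-pred : ∀ {x y} → x ≡ suc y → + y ≡ ℤ.pred (+ x)
  value-pred refl = refl
  separated-at : ∀ x → Separator σ (σ ⟨$⟩ʳ x) → Separated (graph σ) (toℕ x) (+ toℕ (σ ⟨$⟩ʳ x))
  -- The rewriting turns the position of the digit back into `x` and shows `toℕ x` as a successor,
  -- the index form of vertical separation.
  separated-at x (inj₁ (j , k , (e , e′) , d)) rewrite inverseˡ σ {x} | e
    with ∣m-n∣≡1⇒ (toℕ (σ ⟨$⟩ʳ j)) _ d
  ... | inj₁ f = ascent (j , refl , refl) (k , e′ , cong +_ f)
  ... | inj₂ f = descent (j , refl , refl) (k , e′ , value-pred f)
  separated-at x (inj₂ (b , d , (e , e′) , δ)) with ∣m-n∣≡1⇒ (toℕ (σ ⟨$⟩ˡ b)) _ δ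
  ... | inj₁ f = rowsAscend (subst (graph σ _) (value-pred e) (digit b))
                   (subst₂ (graph σ) f (cong +_ e′) (digit d))
  ... | inj₂ f = rowsDescend (subst (graph σ _) (cong +_ e′) (digit d))
                   (subst₂ (graph σ) f (value-pred e) (digit b))

-- Aligning the rows of the tiles to multiples of 4

motif-inverse : ∀ t r → motif (opposite t) (motif t r) ≡ r
motif-inverse 0F 0F = refl
motif-inverse 0F 1F = refl
motif-inverse 0F 2F = refl
motif-inverse 0F 3F = refl
motif-inverse 1F 0F = refl
motif-inverse 1F 1F = refl
motif-inverse 1F 2F = refl
motif-inverse 1F 3F = refl

motif-inverse′ : ∀ t r → motif t (motif (opposite t) r) ≡ r
motif-inverse′ 0F = motif-inverse 1F
motif-inverse′ 1F = motif-inverse 0F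

-- The columns 4q, …, 4q + 3 and the rows 4m, …, 4m + 3 meet in the motif t.
record Meets (σ : Permutation′ (k * 4)) (q m : Fin k) (t : Fin 2) : Set where
  constructor meets
  field
    image : ∀ r → σ ⟨$⟩ʳ combine q r ≡ combine m (motif t r)

open Meets

toℕ-combine₄ : ∀ (q : Fin k) (r : Fin 4) → toℕ (combine q r) ≡ toℕ q * 4 + toℕ r
toℕ-combine₄ q r = trans (toℕ-combine q r) (cong (_+ toℕ r) (ℕ.*-comm 4 (toℕ q)))

module Alignment (σ : Permutation′ (k * 4))
                 (tile : (q : Fin k) → Tile (graph σ) (toℕ q * 4)) where

  -- The integer base of a tile is itself a digit, the entry where the motif takes the value 0, and
  -- hence a natural number.
  ⟨$⟩ʳ-combine : (q : Fin k) → ∃[ t ] ∃[ b ] ∀ r →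
                 toℕ (σ ⟨$⟩ʳ combine q r) ≡ b + toℕ (motif t r)
  ⟨$⟩ʳ-combine q with tile q
  ... | t , b , at = t , toℕ (σ ⟨$⟩ʳ combine q low) , λ r →
        ℤ.+-injective (trans (at′ r) (cong (ℤ._+ + toℕ (motif t r)) b≡))
    where
    low = motif (opposite t) 0F
    at′ : ∀ r → + toℕ (σ ⟨$⟩ʳ combine q r) ≡ b ℤ.+ + toℕ (motif t r)
    at′ r with at r
    ... | x , e , f with refl ← toℕ-injective (trans e (sym (toℕ-combine₄ q r))) = f
    b≡ : b ≡ + toℕ (σ ⟨$⟩ʳ combine q low)
    b≡ = sym (trans (at′ low) (trans (cong (λ s → b ℤ.+ + toℕ s) (motif-inverse′ t 0F))
               (ℤ.+-identityʳ b)))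

  same-column : ∀ {q q′ : Fin k} {r r′ : Fin 4} →
                toℕ (σ ⟨$⟩ʳ combine q r) ≡ toℕ (σ ⟨$⟩ʳ combine q′ r′) → q ≡ q′
  same-column e = combine-injectiveˡ _ _ _ _ (Injection.injective (↔⇒↣ σ) (toℕ-injective e))

  complement : ∀ b c (s : Fin 3) → b + toℕ (suc s) ≡ 4 + c → ∃[ s′ ] b ≡ c + toℕ {4} s′
  complement b c = λ
    { 0F → solution 3F 1 refl
    ; 1F → solution 2F 2 refl
    ; 2F → solution 1F 3 refl
    }
    where
    solution : ∀ s′ s → toℕ {4} s′ + s ≡ 4 → b + s ≡ 4 + c → ∃[ s′ ] b ≡ c + toℕ {4} s′
    solution s′ s e′ e = s′ , ℕ.+-cancelʳ-≡ s b (c + toℕ s′)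
      (trans e (trans (ℕ.+-comm 4 c) (trans (cong (λ x → c + x) (sym e′))
        (sym (ℕ.+-assoc c (toℕ s′) s)))))

  Row : ℕ → Set
  Row m = ∃[ q ] ∃[ t ] ∀ r → toℕ (σ ⟨$⟩ʳ combine {k} q r) ≡ m * 4 + toℕ (motif t r)

  -- A tile with base b < 4m = b + s would share the digit b with the tile
  -- whose base is 4(m - 1), and that tile does not reach up to 4m.
  row : ∀ m → m < k → Row m
  row m m<k with combine-surjective {k} {4} (σ ⟨$⟩ˡ fromℕ< (ℕ.*-monoˡ-< 4 m<k))
  ... | q , r , e with ⟨$⟩ʳ-combine q
  ...   | t , b , at = go m m<k (motif t r) (trans (sym (at r)) hit) hit
    where
    hit : toℕ (σ ⟨$⟩ʳ combine q r) ≡ m * 4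
    hit = trans (cong toℕ (trans (cong (σ ⟨$⟩ʳ_) e) (inverseʳ σ))) (toℕ-fromℕ< _)
    base : toℕ (σ ⟨$⟩ʳ combine q (motif (opposite t) 0F)) ≡ b
    base = trans (at _) (trans (cong (λ s → b + toℕ s) (motif-inverse′ t 0F)) (ℕ.+-identityʳ b))
    overshoot : ∀ m s → b ≡ m * 4 + toℕ {4} s → toℕ (σ ⟨$⟩ʳ combine q r) ≡ suc m * 4 → Row m → ⊥
    overshoot m s g hit (q′ , t′ , at′) with refl ← same-column {q} {q′} {r′ = motif (opposite t′) s} (trans base (trans g
      (trans (cong (λ s → m * 4 + toℕ s) (sym (motif-inverse′ t′ s))) (sym (at′ _))))) =
      ℕ.<-irrefl motif≡4 (toℕ<n (motif t′ r))
      where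
      motif≡4 : toℕ (motif t′ r) ≡ 4
      motif≡4 = ℕ.+-cancelˡ-≡ (m * 4) _ 4
        (trans (sym (at′ r)) (trans hit (ℕ.+-comm 4 (m * 4))))
    go : ∀ m → m < k → (s : Fin 4) → b + toℕ s ≡ m * 4 →
         toℕ (σ ⟨$⟩ʳ combine q r) ≡ m * 4 → Row m
    go m _ zero f _ = q , t , λ r →
      trans (at r) (cong (_+ toℕ (motif t r)) (trans (sym (ℕ.+-identityʳ b)) f))
    go zero _ (suc s) f _ with () ← trans (sym (ℕ.+-suc b _)) f
    go (suc m) m<k (suc s) f hit with complement b (m * 4) s f
    ... | s′ , g = ⊥-elim (overshoot m s′ g hit (row m (ℕ.<-trans (ℕ.n<1+n m) m<k)))

  row-meets : (m : Fin k) → ∃[ q ] ∃[ t ] Meets σ q m t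
  row-meets m with row (toℕ m) (toℕ<n m)
  ... | q , t , at = q , t , meets λ r →
        toℕ-injective (trans (at r) (sym (toℕ-combine₄ m (motif t r))))

  -- The digit in column 4q belongs to some block of rows. The tile filling those rows contains that
  -- digit, so by injectivity its columns are those of `q`.
  column-meets : (q : Fin k) → ∃[ m ] ∃[ t ] Meets σ q m t
  column-meets q with combine-surjective {k} {4} (σ ⟨$⟩ʳ combine q 0F)
  ... | m , s , e with row-meets m
  ...   | q′ , t , M
      with refl ← same-column {q′} {q} {motif (opposite t) s} {0F}
        (cong toℕ (trans (image M _) (trans (cong (combine m) (motif-inverse′ t s)) e)))
      = m , t , M

-- Inflations consist of separators

preimage : {σ : Permutation′ (k * 4)} {q m : Fin k} {t : Fin 2} → Meets σ q m t →
           ∀ r → σ ⟨$⟩ˡ combine m (motif t r) ≡ combine q r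
preimage {σ = σ} M r = trans (cong (σ ⟨$⟩ˡ_) (sym (image M r))) (inverseˡ σ)

combine-neighbours : (m : Fin k) (s₀ s s₁ : Fin 4) → Neighbours s s₀ s₁ →
                     Neighbours (combine m s) (combine m s₀) (combine m s₁)
combine-neighbours m s₀ s s₁ (e , e′) = next s₀ s e , next s s₁ e′
  where
  next : ∀ s s′ → toℕ s′ ≡ suc (toℕ s) → toℕ (combine m s′) ≡ suc (toℕ (combine m s))
  next s s′ f = trans (toℕ-combine m s′) (trans (cong (λ w → 4 * toℕ m + w) f)
    (trans (ℕ.+-suc _ (toℕ s)) (cong suc (sym (toℕ-combine m s)))))

∣combine-combine∣ : (m : Fin k) (s s′ : Fin 4) →
                    ∣ toℕ (combine m s) - toℕ (combine m s′) ∣ ≡ ∣ toℕ s - toℕ s′ ∣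
∣combine-combine∣ m s s′ rewrite toℕ-combine m s | toℕ-combine m s′ =
  ℕ.∣m+n-m+o∣≡∣n-o∣ (4 * toℕ m) (toℕ s) (toℕ s′)

-- In 2413 and 3142 the outer two digits are horizontal separators and the inner two are vertical
-- ones, with witnesses inside the motif; adjacency inside a block is adjacency in `σ`.
meets-separator : (σ : Permutation′ (k * 4)) {q m : Fin k} {t : Fin 2} → Meets σ q m t →
                  ∀ r → Separator σ (combine m (motif t r))
meets-separator {k = k} σ {q} {m} {t} M = go t refl
  where
  vertical : ∀ r₀ r r₁ → Neighbours r r₀ r₁ →
             ∣ toℕ (motif t r₀) - toℕ (motif t r₁) ∣ ≡ 1 → Separator σ (combine m (motif t r))
  vertical r₀ r r₁ adjacent d = inj₁ (combine q r₀ , combine q r₁ ,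
    subst (λ i → Neighbours i (combine q r₀) (combine q r₁)) (sym (preimage M r))
      (combine-neighbours q r₀ r r₁ adjacent) ,
    trans (cong₂ (λ a b → ∣ toℕ a - toℕ b ∣) (image M r₀) (image M r₁))
      (trans (∣combine-combine∣ m _ _) d))
  horizontal : ∀ r₀ r r₁ → Neighbours (motif t r) (motif t r₀) (motif t r₁) →
               ∣ toℕ r₀ - toℕ r₁ ∣ ≡ 1 → Separator σ (combine m (motif t r))
  horizontal r₀ r r₁ adjacent d = inj₂ (combine m (motif t r₀) , combine m (motif t r₁) ,
    combine-neighbours m (motif t r₀) (motif t r) (motif t r₁) adjacent ,
    trans (cong₂ (λ a b → ∣ toℕ a - toℕ b ∣) (preimage M r₀) (preimage M r₁))
      (trans (∣combine-combine∣ q r₀ r₁) d))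
  go : ∀ t′ → t ≡ t′ → ∀ r → Separator σ (combine m (motif t r))
  go 0F refl 0F = horizontal 2F 0F 3F (refl , refl) refl
  go 0F refl 1F = vertical 0F 1F 2F (refl , refl) refl
  go 0F refl 2F = vertical 1F 2F 3F (refl , refl) refl
  go 0F refl 3F = horizontal 0F 3F 1F (refl , refl) refl
  go 1F refl 0F = horizontal 3F 0F 2F (refl , refl) refl
  go 1F refl 1F = vertical 0F 1F 2F (refl , refl) refl
  go 1F refl 2F = vertical 1F 2F 3F (refl , refl) refl
  go 1F refl 3F = horizontal 1F 3F 0F (refl , refl) refl

inflate : Permutation′ k → (Fin k → Fin 2) → Permutation′ (k * 4)
inflate {k} τ f = permutation to from to-from from-to
  where
  place : Fin k × Fin 4 → Fin (k * 4)
  place (q , r) = combine (τ ⟨$⟩ʳ q) (motif (f q) r)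
  unplace : Fin k × Fin 4 → Fin (k * 4)
  -- The two motifs are mutually inverse, hence `opposite`.
  unplace (m , s) = combine (τ ⟨$⟩ˡ m) (motif (opposite (f (τ ⟨$⟩ˡ m))) s)
  to from : Fin (k * 4) → Fin (k * 4)
  to x = place (remQuot {k} 4 x)
  from y = unplace (remQuot {k} 4 y)
  to-from : ∀ y → to (from y) ≡ y
  to-from y = let m , s = remQuot {k} 4 y in
    trans (cong place (remQuot-combine (τ ⟨$⟩ˡ m) _))
    (trans (cong₂ combine (inverseʳ τ) (motif-inverse′ (f (τ ⟨$⟩ˡ m)) s)) (combine-remQuot {k} 4 y))
  from-to : ∀ x → from (to x) ≡ x
  from-to x = let q , r = remQuot {k} 4 x in
    trans (cong unplace (remQuot-combine (τ ⟨$⟩ʳ q) _))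
    (trans (cong (λ p → combine p (motif (opposite (f p)) (motif (f q) r))) (inverseˡ τ))
    (trans (cong (combine q) (motif-inverse (f q) r)) (combine-remQuot {k} 4 x)))

inflate-meets : (τ : Permutation′ k) (f : Fin k → Fin 2) →
                ∀ q → Meets (inflate τ f) q (τ ⟨$⟩ʳ q) (f q)
inflate-meets τ f q = meets λ r →
  cong (λ (q , r) → combine (τ ⟨$⟩ʳ q) (motif (f q) r)) (remQuot-combine q r)

inflate-separator : (τ : Permutation′ k) (f : Fin k → Fin 2) → ∀ a → Separator (inflate τ f) a
inflate-separator {k} τ f a with combine-surjective {k} {4} (inflate τ f ⟨$⟩ˡ a)
... | q , r , e = subst (Separator (inflate τ f))
        (trans (sym (image (inflate-meets τ f q) r))
          (trans (cong (inflate τ f ⟨$⟩ʳ_) e) (inverseʳ (inflate τ f))))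
        (meets-separator (inflate τ f) {q = q} (inflate-meets τ f q) r)

-- Recovering the outline and the motifs

motif-injective : ∀ t t′ → motif t 0F ≡ motif t′ 0F → t ≡ t′
motif-injective 0F 0F _ = refl
motif-injective 0F 1F ()
motif-injective 1F 0F ()
motif-injective 1F 1F _ = refl

-- The entry in column 4q suffices: its block of rows gives `m`, and its place in that block, 1 or
-- 2, tells the motifs apart. Allowing two permutations related by `≈` serves the injectivity of the
-- enumeration as well as `deflate`.
meets-unique : (σ σ′ : Permutation′ (k * 4)) → σ ≈ σ′ → {q m m′ : Fin k} {t t′ : Fin 2} →
               Meets σ q m t → Meets σ′ q m′ t′ → m ≡ m′ × t ≡ t′
meets-unique σ σ′ σ≈σ′ {q} {m} {m′} {t} {t′} M M′ =
  proj₁ eqs , motif-injective t t′ (proj₂ eqs)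
  where
  eqs : m ≡ m′ × motif t 0F ≡ motif t′ 0F
  eqs = combine-injective m (motif t 0F) m′ (motif t′ 0F)
    (trans (sym (image M 0F)) (trans (σ≈σ′ (combine q 0F)) (image M′ 0F)))

-- Both tiles contain the digit 4m, which has only one column.
meets-same-column : {σ : Permutation′ (k * 4)} {q q′ m : Fin k} {t t′ : Fin 2} →
                    Meets σ q m t → Meets σ q′ m t′ → q ≡ q′
meets-same-column {k} {σ} {q} {q′} {m} {t} {t′} M M′ =
  combine-injectiveˡ q r q′ r′ (trans (sym (preimage M r))
    (trans (cong position (trans (motif-inverse′ t 0F) (sym (motif-inverse′ t′ 0F))))
           (preimage M′ r′)))
  where
  r r′ : Fin 4
  r = motif (opposite t) 0F
  r′ = motif (opposite t′) 0F
  position : Fin 4 → Fin (k * 4)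
  position s = σ ⟨$⟩ˡ combine m s

module Deflation (σ : Permutation′ (k * 4))
                 (row    : (m : Fin k) → ∃[ q ] ∃[ t ] Meets σ q m t)
                 (column : (q : Fin k) → ∃[ m ] ∃[ t ] Meets σ q m t) where

  column-meets : ∀ q → Meets σ q (proj₁ (column q)) (proj₁ (proj₂ (column q)))
  column-meets q = proj₂ (proj₂ (column q))

  row-meets : ∀ m → Meets σ (proj₁ (row m)) m (proj₁ (proj₂ (row m)))
  row-meets m = proj₂ (proj₂ (row m))

  deflate : Permutation′ k
  deflate = permutation (λ q → proj₁ (column q)) (λ m → proj₁ (row m))
    (λ m → proj₁ (meets-unique σ σ (λ _ → refl) (column-meets (proj₁ (row m))) (row-meets m)))
    (λ q → meets-same-column (row-meets (proj₁ (column q))) (column-meets q))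

  motifs : Fin k → Fin 2
  motifs q = proj₁ (proj₂ (column q))

  inflate-deflate : inflate deflate motifs ≈ σ
  inflate-deflate x with combine-surjective {k} {4} x
  ... | q , r , refl = trans (image (inflate-meets deflate motifs q) r)
                             (sym (image (column-meets q) r))

  inflation : ∃[ τ ] ∃[ f ] inflate τ f ≈ σ
  inflation = deflate , motifs , inflate-deflate

fullySeparated⇒inflation : (σ : Permutation′ (k * 4)) → (∀ a → Separator σ a) →
                           ∃[ τ ] ∃[ f ] inflate {k} τ f ≈ σ
fullySeparated⇒inflation {k} σ separator = align (tiles (graph-fullySeparated σ separator))
  where
  align : ∃[ k′ ] k * 4 ≡ k′ * 4 × ((q : Fin k′) → Tile (graph σ) (toℕ q * 4)) →
          ∃[ τ ] ∃[ f ] inflate {k} τ f ≈ σ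
  -- The tiling brings its own count `k′`; cancelling 4 identifies it with `k`.
  align (k′ , e , tile) with refl ← ℕ.*-cancelʳ-≡ k k′ 4 e =
    Deflation.inflation σ (Alignment.row-meets σ tile) (Alignment.column-meets σ tile)

-- Having `n` separators means that every digit is one

numberOfSeparators≡n⇒ : (σ : Permutation′ n) → numberOfSeparators σ ≡ n → ∀ a → Separator σ a
numberOfSeparators≡n⇒ {n} σ e a with separator? σ a
... | yes p = p
... | no ¬p = ⊥-elim (ℕ.<-irrefl (trans e (sym (length-tabulate {n = n} (λ i → i))))
                (filter-notAll (separator? σ) (allFin n) (lose (∈-allFin a) ¬p)))

⇒numberOfSeparators≡n : (σ : Permutation′ n) → (∀ a → Separator σ a) → numberOfSeparators σ ≡ n
⇒numberOfSeparators≡n {n} σ p =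
  trans (cong length (filter-all (separator? σ) (All.universal p (allFin n))))
        (length-tabulate {n = n} (λ i → i))

-- Enumerating permutations and choices of motifs

arrangement : ∀ k → Fin (k !) → Permutation′ k
arrangement zero    _ = Permutation.id
arrangement (suc k) x =
  -- This is the Lehmer code: the first factor of `suc k * k !` is the image of 0, and the second
  -- codes the permutation left after removing it.
  insert 0F (quotient {suc k} (k !) x) (arrangement k (remainder {suc k} (k !) x))

rank : ∀ k → Permutation′ k → Fin (k !)
rank zero    _ = 0F
rank (suc k) σ = combine (σ ⟨$⟩ʳ 0F) (rank k (remove 0F σ))

remQuot-injective : ∀ m {x y : Fin (n * m)} → quotient {n} m x ≡ quotient m y →
                    remainder {n} m x ≡ remainder {n} m y → x ≡ y
remQuot-injective {n} m {x} {y} p q =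
  trans (sym (combine-remQuot {n} m x)) (trans (cong₂ combine p q) (combine-remQuot {n} m y))

arrangement-injective : ∀ k {x y} → arrangement k x ≈ arrangement k y → x ≡ y
arrangement-injective zero {0F} {0F} _ = refl
arrangement-injective (suc k) {x} {y} e =
  remQuot-injective {suc k} (k !) (e 0F) (arrangement-injective k λ i →
    -- Agreement at 0 makes both `punchIn`s skip the same value.
    punchIn-injective (quotient {suc k} (k !) x) _ _
      (trans (sym (insert-punchIn 0F _ (arrangement k _) i))
      (trans (e (suc i)) (trans (insert-punchIn 0F _ (arrangement k _) i)
      (cong (λ j → punchIn j _) (sym (e 0F)))))))

arrangement-rank : ∀ k σ → arrangement k (rank k σ) ≈ σ
arrangement-rank (suc k) σ i = trans
  (cong (λ (j , x) → insert 0F j (arrangement k x) ⟨$⟩ʳ i)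
    (remQuot-combine {suc k} {k !} (σ ⟨$⟩ʳ 0F) (rank k (remove 0F σ))))
  (reinsert i)
  where
  reinsert : insert 0F (σ ⟨$⟩ʳ 0F) (arrangement k (rank k (remove 0F σ))) ≈ σ
  reinsert 0F      = refl
  reinsert (suc i) = trans (insert-punchIn 0F _ (arrangement k _) i)
    (trans (cong (punchIn (σ ⟨$⟩ʳ 0F)) (arrangement-rank k (remove 0F σ) i))
           (sym (punchIn-permute σ 0F i)))

finToFun-injective : ∀ {m n} {x y : Fin (m ^ n)} →
                     (∀ i → finToFun {m} {n} x i ≡ finToFun {m} {n} y i) → x ≡ y
finToFun-injective {m} {zero} {0F} {0F} _ = refl
finToFun-injective {m} {suc n} e =
  remQuot-injective {m} (m ^ n) (e 0F) (finToFun-injective {m} {n} λ i → e (suc i))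

-- Injectivity of `f` and the section law together force `g` to respect the equivalence, which
-- spares a congruence proof for the ranking.
hasCardinality : ∀ {c ℓ N} (S : Setoid c ℓ) (let open Setoid S renaming (_≈_ to _≋_)) →
                 (f : Fin N → Carrier) (g : Carrier → Fin N) →
                 (∀ {x y} → f x ≋ f y → x ≡ y) → (∀ s → f (g s) ≋ s) → HasCardinality S N
hasCardinality S f g injective section = record
  { to        = f
  ; from      = g
  ; to-cong   = λ { refl → S.refl }
  ; from-cong = λ {s} {s′} e → injective (S.trans (section s) (S.trans e (S.sym (section s′))))
  ; inverse   = (λ { {s} refl → section s }) , (λ {x} {s} e → injective (S.trans (section s) e))
  }
  where module S = Setoid S

-- Counting the inflations

inflate-cong : {τ τ′ : Permutation′ k} {f f′ : Fin k → Fin 2} → τ ≈ τ′ → (∀ q → f q ≡ f′ q) →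
               inflate τ f ≈ inflate τ′ f′
inflate-cong {k} p e x = let q , r = remQuot {k} 4 x in
  cong₂ (λ m t → combine m (motif t r)) (p q) (e q)

module _ (k : ℕ) where

  choices : Fin (2 ^ k * k !) → Fin k → Fin 2
  choices x = finToFun (quotient {2 ^ k} (k !) x)

  outline : Fin (2 ^ k * k !) → Permutation′ k
  outline x = arrangement k (remainder {2 ^ k} (k !) x)

  nthInflation : Fin (2 ^ k * k !) → Permutation′ (k * 4)
  nthInflation x = inflate (outline x) (choices x)

  nthInflation-injective : ∀ {x y} → nthInflation x ≈ nthInflation y → x ≡ y
  nthInflation-injective {x} {y} e = remQuot-injective {2 ^ k} (k !)
    (finToFun-injective {2} {k} λ q → proj₂ (unique q))
    (arrangement-injective k λ q → proj₁ (unique q))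
    where
    unique : ∀ q → outline x ⟨$⟩ʳ q ≡ outline y ⟨$⟩ʳ q × choices x q ≡ choices y q
    unique q = meets-unique (nthInflation x) (nthInflation y) e
      (inflate-meets (outline x) (choices x) q) (inflate-meets (outline y) (choices y) q)

  nthInflation-combine : ∀ τ f → nthInflation (combine (funToFin f) (rank k τ)) ≈ inflate τ f
  nthInflation-combine τ f i = trans
    (cong (λ (x , y) → inflate (arrangement k y) (finToFun x) ⟨$⟩ʳ i)
      (remQuot-combine {2 ^ k} {k !} (funToFin f) (rank k τ)))
    (inflate-cong {τ = arrangement k (rank k τ)} {τ} {finToFun (funToFin f)} {f}
      (arrangement-rank k τ) (finToFun-funToFin f) i)

  fullySeparated-cardinality :
    HasCardinality (PermutationsWithSeparators (k * 4) (k * 4)) (2 ^ k * k !)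
  fullySeparated-cardinality = hasCardinality (PermutationsWithSeparators (k * 4) (k * 4))
    (λ x → nthInflation x ,
           ⇒numberOfSeparators≡n (nthInflation x) (inflate-separator (outline x) (choices x)))
    (λ s → proj₁ (index s)) nthInflation-injective (λ s → proj₂ (index s))
    where
    index : (s : ∃[ σ ] numberOfSeparators {k * 4} σ ≡ k * 4) → ∃[ x ] nthInflation x ≈ proj₁ s
    index (σ , e) with fullySeparated⇒inflation {k} σ (numberOfSeparators≡n⇒ σ e)
    ... | τ , f , p = combine (funToFin f) (rank k τ) ,
                      λ i → trans (nthInflation-combine τ f i) (p i)

theorem2p7 : (n : ℕ) → 1 ≤ n →
    ((k : ℕ) → 1 ≤ k → n ≡ 4 * k →
    HasCardinality (PermutationsWithSeparators n n) (2 ^ k * k !))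
    × (¬ (∃[ k ] (1 ≤ k × n ≡ 4 * k)) →
    HasCardinality (PermutationsWithSeparators n n) 0)
theorem2p7 n 1≤n = divisible , indivisible
  where
  divisible : (k : ℕ) → 1 ≤ k → n ≡ 4 * k →
              HasCardinality (PermutationsWithSeparators n n) (2 ^ k * k !)
  divisible k _ refl = subst
    (λ n → HasCardinality (PermutationsWithSeparators n n) (2 ^ k * k !))
    (ℕ.*-comm k 4) (fullySeparated-cardinality k)
  indivisible : ¬ (∃[ k ] (1 ≤ k × n ≡ 4 * k)) → HasCardinality (PermutationsWithSeparators n n) 0
  indivisible ¬4∣n = hasCardinality (PermutationsWithSeparators n n) (λ ())
    (λ s → ⊥-elim (none s)) (λ { {()} }) (λ s → ⊥-elim (none s))
    where
    -- The empty tiling is excluded by `1 ≤ n`.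
    positive : ∀ k → n ≡ k * 4 → 1 ≤ k
    positive zero    refl = 1≤n
    positive (suc _) _    = s≤s z≤n
    none : ¬ (∃[ σ ] numberOfSeparators {n} σ ≡ n)
    none (σ , e) with tiles (graph-fullySeparated σ (numberOfSeparators≡n⇒ σ e))
    ... | k , f , _ = ¬4∣n (k , positive k f , trans f (ℕ.*-comm k 4))
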